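{- Let $(\mathcal{C},\otimes,I,\alpha,\lambda,\rho)$ be a monoidal category, and let $(M,m,e)$ be a monoid in $\mathcal{C}$, with $m:M\otimes M\to M$ and $e:I\to M$. If $M$ is an exponent, then $(M,m,e)$ is a sub-monoid of the monoid of endomorphisms $(M^M,c_M,i_M)$, as witnessed by the monic $\mathrm{rep}=\lfloor m\rfloor : M\to M^M$; that is, $\mathrm{rep}$ is a monomorphism in $\mathcal{C}$, $\mathrm{rep}\circ e=i_M$, and $\mathrm{rep}\circ m=c_M\circ(\mathrm{rep}\otimes\mathrm{rep})$. Moreover, $\mathrm{abs}\circ\mathrm{rep}=\mathrm{id}_M$, where $\mathrm{abs}:M^M\to M$ is the composite $$M^M\xrightarrow{\ \rho^{ -1}_{M^M}\ }M^M\otimes I\xrightarrow{\ \mathrm{id}_{M^M}\otimes e\ }M^M\otimes M\xrightarrow{\ \mathrm{ev}_M\ }M.$$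
   Context: Structure isomorphisms: $\alpha_{A,B,C}:A\otimes(B\otimes C)\to(A\otimes B)\otimes C$, $\lambda_A:I\otimes A\to A$, $\rho_A:A\otimes I\to A$. A monoid in $\mathcal{C}$ is an object $M$ with morphisms $m:M\otimes M\to M$, $e:I\to M$ such that $m\circ(m\otimes\mathrm{id})\circ\alpha=m\circ(\mathrm{id}\otimes m)$, $m\circ(\mathrm{id}\otimes e)=\rho_M$ and $m\circ(e\otimes\mathrm{id})=\lambda_M$. An object $A$ of $\mathcal{C}$ is called an exponent if the functor $-\otimes A$ has a right adjoint $(-)^A$. The adjunction bijection $\mathcal{C}(X\otimes A,B)\cong\mathcal{C}(X,B^A)$, natural in $X$ and $B$, is written $f\mapsto\lfloor f\rfloor$, with inverse $g\mapsto\lceil g\rceil$; the evaluation morphism is the counit $\mathrm{ev}_B=\lceil\mathrm{id}_{B^A}\rceil:B^A\otimes A\to B$. For an exponent $A$, the monoid of endomorphisms on $A$ is $(A^A,c_A,i_A)$, with unit $i_A=\lfloor\lambda_A\rfloor:I\to A^A$ and multiplication $c_A:A^A\otimes A^A\to A^A$ given by $$c_A=\Big\lfloor (A^A\otimes A^A)\otimes A\xrightarrow{\alpha^{ -1}}A^A\otimes(A^A\otimes A)\xrightarrow{\mathrm{id}\otimes\mathrm{ev}_A}A^A\otimes A\xrightarrow{\mathrm{ev}_A}A\Big\rfloor.$$ -}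

module Defs where

open import Level using (Level; _⊔_; suc)
open import Data.Product using (_×_; _,_; proj₁; proj₂)
open import Function.Bundles using (Inverse)
open import Relation.Binary using (Rel; IsEquivalence; Setoid)
import Relation.Binary.Reasoning.Setoid as SetoidReasoning

-- The standard library has no category theory.  Hom-collections are setoids,
-- so "equal morphisms" always means _≈_.
record Category (o ℓ r : Level) : Set (suc (o ⊔ ℓ ⊔ r)) where
  infixr 9 _∘_
  infix  4 _≈_
  field
    Obj       : Set o
    Hom       : Obj → Obj → Set ℓ
    _≈_       : ∀ {A B} → Rel (Hom A B) r
    id        : ∀ {A} → Hom A A
    _∘_       : ∀ {A B C} → Hom B C → Hom A B → Hom A C
    equiv     : ∀ {A B} → IsEquivalence (_≈_ {A} {B})
    assoc     : ∀ {A B C D} {f : Hom A B} {g : Hom B C} {h : Hom C D} →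
                (h ∘ g) ∘ f ≈ h ∘ (g ∘ f)
    identityˡ : ∀ {A B} {f : Hom A B} → id ∘ f ≈ f
    identityʳ : ∀ {A B} {f : Hom A B} → f ∘ id ≈ f
    ∘-cong    : ∀ {A B C} {f f′ : Hom B C} {g g′ : Hom A B} →
                f ≈ f′ → g ≈ g′ → f ∘ g ≈ f′ ∘ g′

  homSetoid : Obj → Obj → Setoid ℓ r
  homSetoid A B = record { Carrier = Hom A B ; _≈_ = _≈_ ; isEquivalence = equiv }

  IsMono : ∀ {A B} → Hom A B → Set (o ⊔ ℓ ⊔ r)
  IsMono {A} f = ∀ {X} (g h : Hom X A) → f ∘ g ≈ f ∘ h → g ≈ h

  record _≅_ (A B : Obj) : Set (ℓ ⊔ r) where
    field
      to   : Hom A B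
      from : Hom B A
      isoˡ : from ∘ to ≈ id
      isoʳ : to ∘ from ≈ id

_×ᶜ_ : ∀ {o ℓ r o′ ℓ′ r′} → Category o ℓ r → Category o′ ℓ′ r′ →
       Category (o ⊔ o′) (ℓ ⊔ ℓ′) (r ⊔ r′)
C ×ᶜ D = record
  { Obj       = C.Obj × D.Obj
  ; Hom       = λ (A , A′) (B , B′) → C.Hom A B × D.Hom A′ B′
  ; _≈_       = λ (f , f′) (g , g′) → (f C.≈ g) × (f′ D.≈ g′)
  ; id        = C.id , D.id
  ; _∘_       = λ (g , g′) (f , f′) → g C.∘ f , g′ D.∘ f′
  ; equiv     = record
    { refl  = IsEquivalence.refl C.equiv , IsEquivalence.refl D.equiv
    ; sym   = λ (p , p′) → IsEquivalence.sym C.equiv p , IsEquivalence.sym D.equiv p′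
    ; trans = λ (p , p′) (q , q′) →
        IsEquivalence.trans C.equiv p q , IsEquivalence.trans D.equiv p′ q′
    }
  ; assoc     = C.assoc , D.assoc
  ; identityˡ = C.identityˡ , D.identityˡ
  ; identityʳ = C.identityʳ , D.identityʳ
  ; ∘-cong    = λ (p , p′) (q , q′) → C.∘-cong p q , D.∘-cong p′ q′
  }
  where
  module C = Category C
  module D = Category D

record Functor {o ℓ r o′ ℓ′ r′ : Level}
               (C : Category o ℓ r) (D : Category o′ ℓ′ r′) :
               Set (o ⊔ ℓ ⊔ r ⊔ o′ ⊔ ℓ′ ⊔ r′) where
  private
    module C = Category C
    module D = Category D
  field
    F₀           : C.Obj → D.Obj
    F₁           : ∀ {A B} → C.Hom A B → D.Hom (F₀ A) (F₀ B)
    F-resp-≈     : ∀ {A B} {f g : C.Hom A B} → f C.≈ g → F₁ f D.≈ F₁ g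
    identity     : ∀ {A} → F₁ (C.id {A}) D.≈ D.id
    homomorphism : ∀ {X Y Z} {f : C.Hom X Y} {g : C.Hom Y Z} →
                   F₁ (g C.∘ f) D.≈ F₁ g D.∘ F₁ f

record RightAdjoint {o ℓ r o′ ℓ′ r′ : Level}
                    {C : Category o ℓ r} {D : Category o′ ℓ′ r′}
                    (F : Functor C D) : Set (o ⊔ ℓ ⊔ r ⊔ o′ ⊔ ℓ′ ⊔ r′) where
  private
    module C = Category C
    module D = Category D
  open Functor F
  field
    G : Functor D C
  open Functor G renaming (F₀ to G₀; F₁ to G₁) using ()
  field
    bijection : ∀ X B → Inverse (D.homSetoid (F₀ X) B) (C.homSetoid X (G₀ B))

  ⌊_⌋ : ∀ {X B} → D.Hom (F₀ X) B → C.Hom X (G₀ B)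
  ⌊_⌋ {X} {B} = Inverse.to (bijection X B)

  ⌈_⌉ : ∀ {X B} → C.Hom X (G₀ B) → D.Hom (F₀ X) B
  ⌈_⌉ {X} {B} = Inverse.from (bijection X B)

  field
    natural-X : ∀ {X Y B} (f : D.Hom (F₀ Y) B) (h : C.Hom X Y) →
                ⌊ f D.∘ F₁ h ⌋ C.≈ ⌊ f ⌋ C.∘ h
    natural-B : ∀ {X B B′} (g : D.Hom B B′) (f : D.Hom (F₀ X) B) →
                ⌊ g D.∘ f ⌋ C.≈ G₁ g C.∘ ⌊ f ⌋

  counit : ∀ B → D.Hom (F₀ (G₀ B)) B
  counit B = ⌈ C.id {G₀ B} ⌉

record MonoidalCategory (o ℓ r : Level) : Set (suc (o ⊔ ℓ ⊔ r)) where
  infixr 10 _⊗_ _⊗₁_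
  field
    category : Category o ℓ r
  open Category category public
  field
    tensor : Functor (category ×ᶜ category) category
    I      : Obj

  _⊗_ : Obj → Obj → Obj
  A ⊗ B = Functor.F₀ tensor (A , B)

  _⊗₁_ : ∀ {A A′ B B′} → Hom A A′ → Hom B B′ → Hom (A ⊗ B) (A′ ⊗ B′)
  f ⊗₁ g = Functor.F₁ tensor (f , g)

  field
    associator  : ∀ A B C → (A ⊗ (B ⊗ C)) ≅ ((A ⊗ B) ⊗ C)
    leftUnitor  : ∀ A → (I ⊗ A) ≅ A
    rightUnitor : ∀ A → (A ⊗ I) ≅ A

  α : ∀ A B C → Hom (A ⊗ (B ⊗ C)) ((A ⊗ B) ⊗ C)
  α A B C = _≅_.to (associator A B C)

  α⁻¹ : ∀ A B C → Hom ((A ⊗ B) ⊗ C) (A ⊗ (B ⊗ C))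
  α⁻¹ A B C = _≅_.from (associator A B C)

  -- The left unitor λ; λ itself is a reserved symbol.
  ƛ : ∀ A → Hom (I ⊗ A) A
  ƛ A = _≅_.to (leftUnitor A)

  ρ : ∀ A → Hom (A ⊗ I) A
  ρ A = _≅_.to (rightUnitor A)

  ρ⁻¹ : ∀ A → Hom A (A ⊗ I)
  ρ⁻¹ A = _≅_.from (rightUnitor A)

  field
    α-natural : ∀ {A A′ B B′ C C′} (f : Hom A A′) (g : Hom B B′) (h : Hom C C′) →
                α A′ B′ C′ ∘ (f ⊗₁ (g ⊗₁ h)) ≈ ((f ⊗₁ g) ⊗₁ h) ∘ α A B C
    ƛ-natural : ∀ {A B} (f : Hom A B) → ƛ B ∘ (id ⊗₁ f) ≈ f ∘ ƛ A
    ρ-natural : ∀ {A B} (f : Hom A B) → ρ B ∘ (f ⊗₁ id) ≈ f ∘ ρ A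
    pentagon  : ∀ A B C D →
                α (A ⊗ B) C D ∘ α A B (C ⊗ D) ≈
                (α A B C ⊗₁ id) ∘ α A (B ⊗ C) D ∘ (id ⊗₁ α B C D)
    triangle  : ∀ A B → (ρ A ⊗₁ id) ∘ α A I B ≈ id ⊗₁ ƛ B

  -⊗_ : Obj → Functor category category
  -⊗ A = record
    { F₀           = _⊗ A
    ; F₁           = _⊗₁ id
    ; F-resp-≈     = λ p → Functor.F-resp-≈ tensor (p , IsEquivalence.refl equiv)
    ; identity     = Functor.identity tensor
    ; homomorphism = IsEquivalence.trans equiv
        (Functor.F-resp-≈ tensor
          (IsEquivalence.refl equiv , IsEquivalence.sym equiv identityˡ))
        (Functor.homomorphism tensor)
    }

  -- An exponent comes with a chosen right adjoint.
  Exponent : Obj → Set (o ⊔ ℓ ⊔ r)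
  Exponent A = RightAdjoint (-⊗ A)

record Monoid {o ℓ r : Level} (𝒞 : MonoidalCategory o ℓ r) : Set (o ⊔ ℓ ⊔ r) where
  open MonoidalCategory 𝒞
  field
    Carrier    : Obj
    m          : Hom (Carrier ⊗ Carrier) Carrier
    e          : Hom I Carrier
    m-assoc    : m ∘ (m ⊗₁ id) ∘ α Carrier Carrier Carrier ≈ m ∘ (id ⊗₁ m)
    m-unitʳ    : m ∘ (id ⊗₁ e) ≈ ρ Carrier
    m-unitˡ    : m ∘ (e ⊗₁ id) ≈ ƛ Carrier

record IsSubmonoidVia {o ℓ r : Level} {𝒞 : MonoidalCategory o ℓ r} (N P : Monoid 𝒞)
                      (f : MonoidalCategory.Hom 𝒞 (Monoid.Carrier N) (Monoid.Carrier P)) :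
                      Set (o ⊔ ℓ ⊔ r) where
  open MonoidalCategory 𝒞
  private
    module N = Monoid N
    module P = Monoid P
  field
    monic         : IsMono f
    preserves-e   : f ∘ N.e ≈ P.e
    preserves-m   : f ∘ N.m ≈ P.m ∘ (f ⊗₁ f)

module Coherence {o ℓ r : Level} (𝒞 : MonoidalCategory o ℓ r) where
  open MonoidalCategory 𝒞

  module E {A B} = IsEquivalence (equiv {A} {B})
  module R {A B} = SetoidReasoning (homSetoid A B)
  open R

  infixr 4 _⟩∘⟨_ refl⟩∘⟨_
  infixl 5 _⟩∘⟨refl

  _⟩∘⟨_ : ∀ {A B C} {f f′ : Hom B C} {g g′ : Hom A B} →
          f ≈ f′ → g ≈ g′ → f ∘ g ≈ f′ ∘ g′
  _⟩∘⟨_ = ∘-cong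

  refl⟩∘⟨_ : ∀ {A B C} {f : Hom B C} {g g′ : Hom A B} → g ≈ g′ → f ∘ g ≈ f ∘ g′
  refl⟩∘⟨ p = E.refl ⟩∘⟨ p

  _⟩∘⟨refl : ∀ {A B C} {f f′ : Hom B C} {g : Hom A B} → f ≈ f′ → f ∘ g ≈ f′ ∘ g
  p ⟩∘⟨refl = p ⟩∘⟨ E.refl

  pullˡ : ∀ {A B C D} {f : Hom C D} {g : Hom B C} {h : Hom B D} {k : Hom A B} →
          f ∘ g ≈ h → f ∘ g ∘ k ≈ h ∘ k
  pullˡ p = E.trans (E.sym assoc) (p ⟩∘⟨refl)

  extend : ∀ {A B B′ C D} {f : Hom C D} {g : Hom B C} {f′ : Hom B′ D} {g′ : Hom B B′}
           {k : Hom A B} → f ∘ g ≈ f′ ∘ g′ → f ∘ g ∘ k ≈ f′ ∘ g′ ∘ k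
  extend p = E.trans (pullˡ p) assoc

  ⊗-cong : ∀ {A A′ B B′} {f f′ : Hom A A′} {g g′ : Hom B B′} →
           f ≈ f′ → g ≈ g′ → f ⊗₁ g ≈ f′ ⊗₁ g′
  ⊗-cong p q = Functor.F-resp-≈ tensor (p , q)

  ⊗-id : ∀ {A B} → id {A} ⊗₁ id {B} ≈ id
  ⊗-id = Functor.identity tensor

  ⊗-∘ : ∀ {A A′ A″ B B′ B″} {f : Hom A A′} {f′ : Hom A′ A″}
        {g : Hom B B′} {g′ : Hom B′ B″} →
        (f′ ⊗₁ g′) ∘ (f ⊗₁ g) ≈ (f′ ∘ f) ⊗₁ (g′ ∘ g)
  ⊗-∘ = E.sym (Functor.homomorphism tensor)

  ⊗-∘ˡ : ∀ {A A′ A″ B} {f : Hom A A′} {f′ : Hom A′ A″} →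
         (f′ ⊗₁ id {B}) ∘ (f ⊗₁ id) ≈ (f′ ∘ f) ⊗₁ id
  ⊗-∘ˡ = E.trans ⊗-∘ (⊗-cong E.refl identityˡ)

  ⊗-∘ʳ : ∀ {A B B′ B″} {g : Hom B B′} {g′ : Hom B′ B″} →
         (id {A} ⊗₁ g′) ∘ (id ⊗₁ g) ≈ id ⊗₁ (g′ ∘ g)
  ⊗-∘ʳ = E.trans ⊗-∘ (⊗-cong identityˡ E.refl)

  interchange : ∀ {A A′ B B′} {f : Hom A A′} {g : Hom B B′} →
                (id ⊗₁ g) ∘ (f ⊗₁ id) ≈ (f ⊗₁ id) ∘ (id ⊗₁ g)
  interchange = E.trans (E.trans ⊗-∘ (⊗-cong (E.trans identityˡ (E.sym identityʳ))
                                             (E.trans identityʳ (E.sym identityˡ))))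
                        (E.sym ⊗-∘)

  iso-monic : ∀ {A B X} (i : A ≅ B) {f g : Hom X A} →
              _≅_.to i ∘ f ≈ _≅_.to i ∘ g → f ≈ g
  iso-monic i {f} {g} p = begin
    f                           ≈⟨ identityˡ ⟨
    id ∘ f                      ≈⟨ pullˡ (_≅_.isoˡ i) ⟨
    _≅_.from i ∘ _≅_.to i ∘ f   ≈⟨ refl⟩∘⟨ p ⟩
    _≅_.from i ∘ _≅_.to i ∘ g   ≈⟨ pullˡ (_≅_.isoˡ i) ⟩
    id ∘ g                      ≈⟨ identityˡ ⟩
    g                           ∎

  iso-epic : ∀ {A B X} (i : A ≅ B) {f g : Hom B X} →
             f ∘ _≅_.to i ≈ g ∘ _≅_.to i → f ≈ g
  iso-epic i {f} {g} p = begin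
    f                            ≈⟨ identityʳ ⟨
    f ∘ id                       ≈⟨ refl⟩∘⟨ _≅_.isoʳ i ⟨
    f ∘ _≅_.to i ∘ _≅_.from i    ≈⟨ extend p ⟩
    g ∘ _≅_.to i ∘ _≅_.from i    ≈⟨ refl⟩∘⟨ _≅_.isoʳ i ⟩
    g ∘ id                       ≈⟨ identityʳ ⟩
    g                            ∎

  α⁻¹-natural : ∀ {A A′ B B′ C C′} (f : Hom A A′) (g : Hom B B′) (h : Hom C C′) →
                α⁻¹ A′ B′ C′ ∘ ((f ⊗₁ g) ⊗₁ h) ≈ (f ⊗₁ (g ⊗₁ h)) ∘ α⁻¹ A B C
  α⁻¹-natural f g h = iso-monic (associator _ _ _) (begin
    α _ _ _ ∘ α⁻¹ _ _ _ ∘ ((f ⊗₁ g) ⊗₁ h)     ≈⟨ pullˡ (_≅_.isoʳ (associator _ _ _)) ⟩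
    id ∘ ((f ⊗₁ g) ⊗₁ h)                      ≈⟨ E.trans identityˡ (E.sym identityʳ) ⟩
    ((f ⊗₁ g) ⊗₁ h) ∘ id                      ≈⟨ refl⟩∘⟨ _≅_.isoʳ (associator _ _ _) ⟨
    ((f ⊗₁ g) ⊗₁ h) ∘ α _ _ _ ∘ α⁻¹ _ _ _     ≈⟨ extend (α-natural f g h) ⟨
    α _ _ _ ∘ (f ⊗₁ (g ⊗₁ h)) ∘ α⁻¹ _ _ _     ∎)

  pentagon⁻¹ : ∀ A B C D →
               α⁻¹ A B (C ⊗ D) ∘ α⁻¹ (A ⊗ B) C D ∘ (α A B C ⊗₁ id) ≈
               (id ⊗₁ α⁻¹ B C D) ∘ α⁻¹ A (B ⊗ C) D
  pentagon⁻¹ A B C D = iso-monic (associator _ _ _) (iso-monic (associator _ _ _) (begin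
    α _ _ _ ∘ α _ _ _ ∘ α⁻¹ _ _ _ ∘ α⁻¹ _ _ _ ∘ (α A B C ⊗₁ id)
      ≈⟨ refl⟩∘⟨ E.trans (pullˡ (_≅_.isoʳ (associator _ _ _))) identityˡ ⟩
    α _ _ _ ∘ α⁻¹ _ _ _ ∘ (α A B C ⊗₁ id)
      ≈⟨ E.trans (pullˡ (_≅_.isoʳ (associator _ _ _))) identityˡ ⟩
    α A B C ⊗₁ id
      ≈⟨ identityʳ ⟨
    (α A B C ⊗₁ id) ∘ id
      ≈⟨ refl⟩∘⟨ _≅_.isoʳ (associator _ _ _) ⟨
    (α A B C ⊗₁ id) ∘ α _ _ _ ∘ α⁻¹ _ _ _
      ≈⟨ refl⟩∘⟨ refl⟩∘⟨ E.trans (pullˡ (E.trans ⊗-∘ʳ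
           (E.trans (⊗-cong E.refl (_≅_.isoʳ (associator _ _ _))) ⊗-id))) identityˡ ⟨
    (α A B C ⊗₁ id) ∘ α _ _ _ ∘ (id ⊗₁ α B C D) ∘ (id ⊗₁ α⁻¹ B C D) ∘ α⁻¹ _ _ _
      ≈⟨ E.trans (refl⟩∘⟨ E.sym assoc) (E.sym assoc) ⟩
    ((α A B C ⊗₁ id) ∘ α _ _ _ ∘ (id ⊗₁ α B C D)) ∘ (id ⊗₁ α⁻¹ B C D) ∘ α⁻¹ _ _ _
      ≈⟨ pullˡ (pentagon A B C D) ⟨
    α _ _ _ ∘ α _ _ _ ∘ (id ⊗₁ α⁻¹ B C D) ∘ α⁻¹ _ _ _ ∎))

  I⊗-faithful : ∀ {A B} {f g : Hom A B} → id {I} ⊗₁ f ≈ id ⊗₁ g → f ≈ g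
  I⊗-faithful {f = f} {g} p = iso-epic (leftUnitor _)
    (E.trans (E.sym (ƛ-natural f)) (E.trans (refl⟩∘⟨ p) (ƛ-natural g)))

  -- Kelly's redundancy of the left-unit triangle.
  ƛ-⊗ : ∀ A B → (ƛ A ⊗₁ id) ∘ α I A B ≈ ƛ (A ⊗ B)
  ƛ-⊗ A B = I⊗-faithful (iso-monic (associator _ _ _) (begin
    α _ _ _ ∘ (id ⊗₁ ((ƛ A ⊗₁ id) ∘ α I A B))
      ≈⟨ refl⟩∘⟨ ⊗-∘ʳ ⟨
    α _ _ _ ∘ (id ⊗₁ (ƛ A ⊗₁ id)) ∘ (id ⊗₁ α I A B)
      ≈⟨ extend (α-natural _ _ _) ⟩
    ((id ⊗₁ ƛ A) ⊗₁ id) ∘ α _ _ _ ∘ (id ⊗₁ α I A B)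
      ≈⟨ ⊗-cong (triangle I A) E.refl ⟩∘⟨refl ⟨
    (((ρ I ⊗₁ id) ∘ α _ _ _) ⊗₁ id) ∘ α _ _ _ ∘ (id ⊗₁ α I A B)
      ≈⟨ pullˡ ⊗-∘ˡ ⟨
    ((ρ I ⊗₁ id) ⊗₁ id) ∘ (α _ _ _ ⊗₁ id) ∘ α _ _ _ ∘ (id ⊗₁ α I A B)
      ≈⟨ refl⟩∘⟨ pentagon I I A B ⟨
    ((ρ I ⊗₁ id) ⊗₁ id) ∘ α _ _ _ ∘ α _ _ _
      ≈⟨ extend (α-natural _ _ _) ⟨
    α _ _ _ ∘ (ρ I ⊗₁ (id ⊗₁ id)) ∘ α _ _ _
      ≈⟨ refl⟩∘⟨ ⊗-cong E.refl ⊗-id ⟩∘⟨refl ⟩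
    α _ _ _ ∘ (ρ I ⊗₁ id) ∘ α _ _ _
      ≈⟨ refl⟩∘⟨ triangle I (A ⊗ B) ⟩
    α _ _ _ ∘ (id ⊗₁ ƛ (A ⊗ B)) ∎))

module _ {o ℓ r : Level} (𝒞 : MonoidalCategory o ℓ r) where
  open MonoidalCategory 𝒞

  module Endomorphisms {A : Obj} (exp : Exponent A) where
    open RightAdjoint exp public using (⌊_⌋; ⌈_⌉)
    open RightAdjoint exp using (bijection; natural-X)

    infix 11 _^A
    _^A : Obj → Obj
    _^A = Functor.F₀ (RightAdjoint.G exp)

    ev : ∀ B → Hom (B ^A ⊗ A) B
    ev = RightAdjoint.counit exp

    i : Hom I (A ^A)
    i = ⌊ ƛ A ⌋

    c : Hom (A ^A ⊗ A ^A) (A ^A)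
    c = ⌊ ev A ∘ (id ⊗₁ ev A) ∘ α⁻¹ (A ^A) (A ^A) A ⌋

    private
      open Coherence 𝒞
      open R

      E′ : Obj
      E′ = A ^A

      k : Hom ((E′ ⊗ E′) ⊗ A) A
      k = ev A ∘ (id ⊗₁ ev A) ∘ α⁻¹ E′ E′ A

      ⌊⌋-cong : ∀ {X B} {f g : Hom (X ⊗ A) B} → f ≈ g → ⌊ f ⌋ ≈ ⌊ g ⌋
      ⌊⌋-cong {X} {B} = Inverse.to-cong (bijection X B)

      ⌊⌈⌉⌋ : ∀ {X B} (g : Hom X (B ^A)) → ⌊ ⌈ g ⌉ ⌋ ≈ g
      ⌊⌈⌉⌋ {X} {B} = Inverse.strictlyInverseˡ (bijection X B)

      ⌈⌊⌋⌉ : ∀ {X B} (f : Hom (X ⊗ A) B) → ⌈ ⌊ f ⌋ ⌉ ≈ f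
      ⌈⌊⌋⌉ {X} {B} = Inverse.strictlyInverseʳ (bijection X B)

      ⌊ev∘⌋ : ∀ {X B} (g : Hom X (B ^A)) → ⌊ ev B ∘ (g ⊗₁ id) ⌋ ≈ g
      ⌊ev∘⌋ {X} {B} g = begin
        ⌊ ev B ∘ (g ⊗₁ id) ⌋ ≈⟨ natural-X (ev B) g ⟩
        ⌊ ev B ⌋ ∘ g         ≈⟨ ⌊⌈⌉⌋ id ⟩∘⟨refl ⟩
        id ∘ g               ≈⟨ identityˡ ⟩
        g                    ∎

      β : ∀ {X B} (f : Hom (X ⊗ A) B) → ev B ∘ (⌊ f ⌋ ⊗₁ id) ≈ f
      β {X} {B} f = begin
        ev B ∘ (⌊ f ⌋ ⊗₁ id)         ≈⟨ ⌈⌊⌋⌉ _ ⟨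
        ⌈ ⌊ ev B ∘ (⌊ f ⌋ ⊗₁ id) ⌋ ⌉ ≈⟨ Inverse.from-cong (bijection X B) (⌊ev∘⌋ ⌊ f ⌋) ⟩
        ⌈ ⌊ f ⌋ ⌉                    ≈⟨ ⌈⌊⌋⌉ f ⟩
        f                            ∎

      c∘ : ∀ {X} {h : Hom X (E′ ⊗ E′)} → c ∘ h ≈ ⌊ k ∘ (h ⊗₁ id) ⌋
      c∘ {h = h} = E.sym (natural-X k h)

      k∘ : ∀ {X Y} {f : Hom X E′} {g : Hom Y E′} →
           k ∘ ((f ⊗₁ g) ⊗₁ id) ≈ ev A ∘ (f ⊗₁ (ev A ∘ (g ⊗₁ id))) ∘ α⁻¹ X Y A
      k∘ {f = f} {g} = begin
        (ev A ∘ (id ⊗₁ ev A) ∘ α⁻¹ _ _ _) ∘ ((f ⊗₁ g) ⊗₁ id)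
          ≈⟨ E.trans assoc (refl⟩∘⟨ assoc) ⟩
        ev A ∘ (id ⊗₁ ev A) ∘ α⁻¹ _ _ _ ∘ ((f ⊗₁ g) ⊗₁ id)
          ≈⟨ refl⟩∘⟨ refl⟩∘⟨ α⁻¹-natural f g id ⟩
        ev A ∘ (id ⊗₁ ev A) ∘ (f ⊗₁ (g ⊗₁ id)) ∘ α⁻¹ _ _ _
          ≈⟨ refl⟩∘⟨ pullˡ (E.trans ⊗-∘ (⊗-cong identityˡ E.refl)) ⟩
        ev A ∘ (f ⊗₁ (ev A ∘ (g ⊗₁ id))) ∘ α⁻¹ _ _ _ ∎

      split : ∀ {X Y B} {f : Hom X E′} {g : Hom Y A} {h : Hom B (X ⊗ Y)} →
              ev A ∘ (f ⊗₁ g) ∘ h ≈ (ev A ∘ (f ⊗₁ id)) ∘ (id ⊗₁ g) ∘ h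
      split = E.trans
        (refl⟩∘⟨ E.sym (pullˡ (E.trans ⊗-∘ (⊗-cong identityʳ identityˡ))))
        (E.sym assoc)

      ev-id : ev A ∘ (id ⊗₁ id) ≈ ev A
      ev-id = E.trans (refl⟩∘⟨ ⊗-id) identityʳ

      c-unitˡ : c ∘ (i ⊗₁ id) ≈ ƛ E′
      c-unitˡ = E.trans c∘ (E.trans (⌊⌋-cong (begin
        k ∘ ((i ⊗₁ id) ⊗₁ id)
          ≈⟨ k∘ ⟩
        ev A ∘ (i ⊗₁ (ev A ∘ (id ⊗₁ id))) ∘ α⁻¹ _ _ _
          ≈⟨ refl⟩∘⟨ ⊗-cong E.refl ev-id ⟩∘⟨refl ⟩
        ev A ∘ (i ⊗₁ ev A) ∘ α⁻¹ _ _ _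
          ≈⟨ split ⟩
        (ev A ∘ (i ⊗₁ id)) ∘ (id ⊗₁ ev A) ∘ α⁻¹ _ _ _
          ≈⟨ β (ƛ A) ⟩∘⟨refl ⟩
        ƛ A ∘ (id ⊗₁ ev A) ∘ α⁻¹ _ _ _
          ≈⟨ extend (ƛ-natural (ev A)) ⟩
        ev A ∘ ƛ (E′ ⊗ A) ∘ α⁻¹ _ _ _
          ≈⟨ refl⟩∘⟨ ƛ-⊗ E′ A ⟩∘⟨refl ⟨
        ev A ∘ ((ƛ E′ ⊗₁ id) ∘ α _ _ _) ∘ α⁻¹ _ _ _
          ≈⟨ refl⟩∘⟨ E.trans assoc (E.trans (refl⟩∘⟨ _≅_.isoʳ (associator _ _ _)) identityʳ) ⟩
        ev A ∘ (ƛ E′ ⊗₁ id) ∎)) (⌊ev∘⌋ (ƛ E′)))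

      c-unitʳ : c ∘ (id ⊗₁ i) ≈ ρ E′
      c-unitʳ = E.trans c∘ (E.trans (⌊⌋-cong (begin
        k ∘ ((id ⊗₁ i) ⊗₁ id)
          ≈⟨ k∘ ⟩
        ev A ∘ (id ⊗₁ (ev A ∘ (i ⊗₁ id))) ∘ α⁻¹ _ _ _
          ≈⟨ refl⟩∘⟨ ⊗-cong E.refl (β (ƛ A)) ⟩∘⟨refl ⟩
        ev A ∘ (id ⊗₁ ƛ A) ∘ α⁻¹ _ _ _
          ≈⟨ refl⟩∘⟨ triangle E′ A ⟩∘⟨refl ⟨
        ev A ∘ ((ρ E′ ⊗₁ id) ∘ α _ _ _) ∘ α⁻¹ _ _ _
          ≈⟨ refl⟩∘⟨ E.trans assoc (E.trans (refl⟩∘⟨ _≅_.isoʳ (associator _ _ _)) identityʳ) ⟩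
        ev A ∘ (ρ E′ ⊗₁ id) ∎)) (⌊ev∘⌋ (ρ E′)))

      c-assoc : c ∘ (c ⊗₁ id) ∘ α E′ E′ E′ ≈ c ∘ (id ⊗₁ c)
      c-assoc = E.trans c∘ (E.trans (⌊⌋-cong (begin
        k ∘ (((c ⊗₁ id) ∘ α _ _ _) ⊗₁ id)
          ≈⟨ refl⟩∘⟨ ⊗-∘ˡ ⟨
        k ∘ ((c ⊗₁ id) ⊗₁ id) ∘ (α _ _ _ ⊗₁ id)
          ≈⟨ pullˡ k∘ ⟩
        (ev A ∘ (c ⊗₁ (ev A ∘ (id ⊗₁ id))) ∘ α⁻¹ _ _ _) ∘ (α _ _ _ ⊗₁ id)
          ≈⟨ (refl⟩∘⟨ ⊗-cong E.refl ev-id ⟩∘⟨refl) ⟩∘⟨refl ⟩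
        (ev A ∘ (c ⊗₁ ev A) ∘ α⁻¹ _ _ _) ∘ (α _ _ _ ⊗₁ id)
          ≈⟨ E.trans assoc (refl⟩∘⟨ assoc) ⟩
        ev A ∘ (c ⊗₁ ev A) ∘ α⁻¹ _ _ _ ∘ (α _ _ _ ⊗₁ id)
          ≈⟨ split ⟩
        (ev A ∘ (c ⊗₁ id)) ∘ (id ⊗₁ ev A) ∘ α⁻¹ _ _ _ ∘ (α _ _ _ ⊗₁ id)
          ≈⟨ β k ⟩∘⟨ ⊗-cong (E.sym ⊗-id) E.refl ⟩∘⟨refl ⟩
        k ∘ ((id ⊗₁ id) ⊗₁ ev A) ∘ α⁻¹ _ _ _ ∘ (α _ _ _ ⊗₁ id)
          ≈⟨ E.trans assoc (refl⟩∘⟨ assoc) ⟩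
        ev A ∘ (id ⊗₁ ev A) ∘ α⁻¹ _ _ _ ∘ ((id ⊗₁ id) ⊗₁ ev A) ∘ α⁻¹ _ _ _ ∘ (α _ _ _ ⊗₁ id)
          ≈⟨ refl⟩∘⟨ refl⟩∘⟨ extend (α⁻¹-natural id id (ev A)) ⟩
        ev A ∘ (id ⊗₁ ev A) ∘ (id ⊗₁ (id ⊗₁ ev A)) ∘ α⁻¹ _ _ _ ∘ α⁻¹ _ _ _ ∘ (α _ _ _ ⊗₁ id)
          ≈⟨ refl⟩∘⟨ refl⟩∘⟨ refl⟩∘⟨ pentagon⁻¹ E′ E′ E′ A ⟩
        ev A ∘ (id ⊗₁ ev A) ∘ (id ⊗₁ (id ⊗₁ ev A)) ∘ (id ⊗₁ α⁻¹ _ _ _) ∘ α⁻¹ _ _ _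
          ≈⟨ refl⟩∘⟨ E.trans (refl⟩∘⟨ pullˡ ⊗-∘ʳ) (pullˡ ⊗-∘ʳ) ⟩
        ev A ∘ (id ⊗₁ k) ∘ α⁻¹ _ _ _
          ≈⟨ refl⟩∘⟨ ⊗-cong E.refl (β k) ⟩∘⟨refl ⟨
        ev A ∘ (id ⊗₁ (ev A ∘ (c ⊗₁ id))) ∘ α⁻¹ _ _ _
          ≈⟨ k∘ ⟨
        k ∘ ((id ⊗₁ c) ⊗₁ id) ∎)) (E.sym c∘))

    -- The monoid laws are not part of the definition of (A^A, c, i); they are
    -- proved above so that "sub-monoid of the monoid of endomorphisms" makes sense.
    endomorphismMonoid : Monoid 𝒞
    endomorphismMonoid = record
      { Carrier = A ^A
      ; m       = c
      ; e       = i
      ; m-assoc = c-assoc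
      ; m-unitʳ = c-unitʳ
      ; m-unitˡ = c-unitˡ
      }

  module Representation (M : Monoid 𝒞) (exp : Exponent (Monoid.Carrier M)) where
    open Monoid M
    open Endomorphisms exp

    M^M : Obj
    M^M = Carrier ^A

    rep : Hom Carrier M^M
    rep = ⌊ m ⌋

    abs : Hom M^M Carrier
    abs = ev Carrier ∘ (id ⊗₁ e) ∘ ρ⁻¹ M^M

{-# OPTIONS --safe #-}
module Submission where

open import Defs
open import Data.Product using (_×_; _,_)
open import Function.Bundles using (Inverse)
open import Level using (Level)
open import Relation.Binary using (IsEquivalence)
import Relation.Binary.Reasoning.Setoid as SetoidReasoning

-- Every equation into M^M is checked on transposes: rep ∘ e = i transposes to
-- the left unit law and rep ∘ m = c ∘ (rep ⊗ rep) to associativity, because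
-- ev ∘ (rep ⊗ id) = m.  Evaluating at the unit turns that same identity into
-- abs ∘ rep = m ∘ (id ⊗ e) ∘ ρ⁻¹ = id, so rep is a split mono.

module _ {o ℓ r o′ ℓ′ r′ : Level} {C : Category o ℓ r} {D : Category o′ ℓ′ r′}
         {F : Functor C D} (adj : RightAdjoint F) where
  private
    module C = Category C
    module D = Category D
  open Functor F using (F₀; F₁)
  open RightAdjoint adj

  ⌊⌋-injective : ∀ {X B} {f g : D.Hom (F₀ X) B} → ⌊ f ⌋ C.≈ ⌊ g ⌋ → f D.≈ g
  ⌊⌋-injective {X} {B} {f} {g} p = begin
    f           ≈⟨ Inverse.strictlyInverseʳ (bijection X B) f ⟨
    ⌈ ⌊ f ⌋ ⌉   ≈⟨ Inverse.from-cong (bijection X B) p ⟩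
    ⌈ ⌊ g ⌋ ⌉   ≈⟨ Inverse.strictlyInverseʳ (bijection X B) g ⟩
    g           ∎
    where open SetoidReasoning (D.homSetoid (F₀ X) B)

  -- This is the β law of the adjunction. Transposition is injective, so it is enough to compare
  -- transposes: naturality in `X` pulls `⌊ f ⌋` out, and the counit is by definition the map that
  -- transposes to `id`.
  counit-⌊⌋ : ∀ {X B} (f : D.Hom (F₀ X) B) → counit B D.∘ F₁ ⌊ f ⌋ D.≈ f
  counit-⌊⌋ {X} {B} f = ⌊⌋-injective (begin
    ⌊ counit B D.∘ F₁ ⌊ f ⌋ ⌋   ≈⟨ natural-X (counit B) ⌊ f ⌋ ⟩
    ⌊ counit B ⌋ C.∘ ⌊ f ⌋      ≈⟨ C.∘-cong (Inverse.strictlyInverseˡ (bijection _ B) C.id)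
                                            (IsEquivalence.refl C.equiv) ⟩
    C.id C.∘ ⌊ f ⌋              ≈⟨ C.identityˡ ⟩
    ⌊ f ⌋                       ∎)
    where open SetoidReasoning (C.homSetoid X (Functor.F₀ G B))

module _ {o ℓ r : Level} (𝒞 : MonoidalCategory o ℓ r) where
  open MonoidalCategory 𝒞
  open Coherence 𝒞
  open R

  retraction⇒mono : ∀ {A B} {f : Hom A B} {g : Hom B A} → g ∘ f ≈ id → IsMono f
  retraction⇒mono {f = f} {g} gf≈id h k p = begin
    h           ≈⟨ identityˡ ⟨
    id ∘ h      ≈⟨ pullˡ gf≈id ⟨
    g ∘ f ∘ h   ≈⟨ refl⟩∘⟨ p ⟩
    g ∘ f ∘ k   ≈⟨ pullˡ gf≈id ⟩
    id ∘ k      ≈⟨ identityˡ ⟩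
    k           ∎

  ρ⁻¹-natural : ∀ {A B} (f : Hom A B) → ρ⁻¹ B ∘ f ≈ (f ⊗₁ id) ∘ ρ⁻¹ A
  ρ⁻¹-natural {A} {B} f = iso-monic (rightUnitor B) (begin
    ρ B ∘ ρ⁻¹ B ∘ f            ≈⟨ pullˡ (_≅_.isoʳ (rightUnitor B)) ⟩
    id ∘ f                     ≈⟨ E.trans identityˡ (E.sym identityʳ) ⟩
    f ∘ id                     ≈⟨ refl⟩∘⟨ _≅_.isoʳ (rightUnitor A) ⟨
    f ∘ ρ A ∘ ρ⁻¹ A            ≈⟨ extend (ρ-natural f) ⟨
    ρ B ∘ (f ⊗₁ id) ∘ ρ⁻¹ A    ∎)

  module _ {A : Obj} (exp : Exponent A) where
    open Endomorphisms 𝒞 exp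
    open RightAdjoint exp using (bijection; natural-X)

    -- Letting `g` act first on the argument leaves `⌊ f ⌋ ⊗₁ id` next to `ev`, where the β law
    -- applies. Stated for arbitrary `g`, it serves both for evaluating at `e` and for the outer
    -- evaluation inside `c`.
    ev-⌊⌋-⊗ : ∀ {X Y} (f : Hom (X ⊗ A) A) (g : Hom Y A) →
              ev A ∘ (⌊ f ⌋ ⊗₁ g) ≈ f ∘ (id ⊗₁ g)
    ev-⌊⌋-⊗ f g = begin
      ev A ∘ (⌊ f ⌋ ⊗₁ g)
        ≈⟨ refl⟩∘⟨ E.trans ⊗-∘ (⊗-cong identityʳ identityˡ) ⟨
      ev A ∘ (⌊ f ⌋ ⊗₁ id) ∘ (id ⊗₁ g)
        ≈⟨ pullˡ (counit-⌊⌋ exp f) ⟩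
      f ∘ (id ⊗₁ g) ∎

    -- `c` is internal composition: the inner evaluation turns `⌊ g ⌋` back into `g`, then the outer
    -- one turns `⌊ f ⌋` back into `f`.
    c-⌊⌋⊗⌊⌋ : ∀ {X Y} (f : Hom (X ⊗ A) A) (g : Hom (Y ⊗ A) A) →
              c ∘ (⌊ f ⌋ ⊗₁ ⌊ g ⌋) ≈ ⌊ f ∘ (id ⊗₁ g) ∘ α⁻¹ X Y A ⌋
    -- Since `c` is itself a transpose, naturality in `X` brings the precomposed map under the
    -- brackets, leaving an equation between untransposed maps.
    c-⌊⌋⊗⌊⌋ f g = E.trans (E.sym (natural-X _ _)) (Inverse.to-cong (bijection _ _) (begin
      (ev A ∘ (id ⊗₁ ev A) ∘ α⁻¹ _ _ _) ∘ ((⌊ f ⌋ ⊗₁ ⌊ g ⌋) ⊗₁ id)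
        ≈⟨ E.trans assoc (refl⟩∘⟨ assoc) ⟩
      ev A ∘ (id ⊗₁ ev A) ∘ α⁻¹ _ _ _ ∘ ((⌊ f ⌋ ⊗₁ ⌊ g ⌋) ⊗₁ id)
        ≈⟨ refl⟩∘⟨ refl⟩∘⟨ α⁻¹-natural ⌊ f ⌋ ⌊ g ⌋ id ⟩
      ev A ∘ (id ⊗₁ ev A) ∘ (⌊ f ⌋ ⊗₁ (⌊ g ⌋ ⊗₁ id)) ∘ α⁻¹ _ _ _
        ≈⟨ refl⟩∘⟨ pullˡ (E.trans ⊗-∘ (⊗-cong identityˡ (counit-⌊⌋ exp g))) ⟩
      ev A ∘ (⌊ f ⌋ ⊗₁ g) ∘ α⁻¹ _ _ _
        ≈⟨ extend (ev-⌊⌋-⊗ f g) ⟩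
      f ∘ (id ⊗₁ g) ∘ α⁻¹ _ _ _ ∎))

  module _ (M : Monoid 𝒞) (exp : Exponent (Monoid.Carrier M)) where
    open Monoid M
    open Endomorphisms 𝒞 exp
    open Representation 𝒞 M exp
    open RightAdjoint exp using (bijection; natural-X)

    abs∘rep : abs ∘ rep ≈ id
    abs∘rep = begin
      (ev Carrier ∘ (id ⊗₁ e) ∘ ρ⁻¹ M^M) ∘ rep
        ≈⟨ E.trans assoc (refl⟩∘⟨ assoc) ⟩
      ev Carrier ∘ (id ⊗₁ e) ∘ ρ⁻¹ M^M ∘ rep
        -- Sliding `rep` past `ρ⁻¹` lets it merge with `e` into one tensor directly in front of
        -- `ev`.
        ≈⟨ refl⟩∘⟨ refl⟩∘⟨ ρ⁻¹-natural rep ⟩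
      ev Carrier ∘ (id ⊗₁ e) ∘ (rep ⊗₁ id) ∘ ρ⁻¹ Carrier
        ≈⟨ refl⟩∘⟨ pullˡ (E.trans ⊗-∘ (⊗-cong identityˡ identityʳ)) ⟩
      ev Carrier ∘ (rep ⊗₁ e) ∘ ρ⁻¹ Carrier
        ≈⟨ pullˡ (E.trans (ev-⌊⌋-⊗ exp m e) m-unitʳ) ⟩
      ρ Carrier ∘ ρ⁻¹ Carrier
        ≈⟨ _≅_.isoʳ (rightUnitor Carrier) ⟩
      id ∎

    rep-preserves-e : rep ∘ e ≈ i
    rep-preserves-e = begin
      ⌊ m ⌋ ∘ e           ≈⟨ natural-X m e ⟨
      -- The chain can end at `i` because `i` unfolds to `⌊ ƛ Carrier ⌋`.
      ⌊ m ∘ (e ⊗₁ id) ⌋   ≈⟨ Inverse.to-cong (bijection _ _) m-unitˡ ⟩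
      i                   ∎

    -- The bracketing in `c` uses `α⁻¹`, while the monoid law has `α` on the other side; cancelling
    -- the epic `α` rewrites the law in the form that `c` produces.
    m-assoc⁻¹ : m ∘ (m ⊗₁ id) ≈ m ∘ (id ⊗₁ m) ∘ α⁻¹ Carrier Carrier Carrier
    m-assoc⁻¹ = iso-epic (associator _ _ _) (begin
      (m ∘ (m ⊗₁ id)) ∘ α _ _ _               ≈⟨ assoc ⟩
      m ∘ (m ⊗₁ id) ∘ α _ _ _                 ≈⟨ m-assoc ⟩
      m ∘ (id ⊗₁ m)                           ≈⟨ refl⟩∘⟨ identityʳ ⟨
      m ∘ (id ⊗₁ m) ∘ id                      ≈⟨ refl⟩∘⟨ refl⟩∘⟨ _≅_.isoˡ (associator _ _ _) ⟨
      m ∘ (id ⊗₁ m) ∘ α⁻¹ _ _ _ ∘ α _ _ _     ≈⟨ E.trans assoc (refl⟩∘⟨ assoc) ⟨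
      (m ∘ (id ⊗₁ m) ∘ α⁻¹ _ _ _) ∘ α _ _ _   ∎)

    rep-preserves-m : rep ∘ m ≈ c ∘ (rep ⊗₁ rep)
    rep-preserves-m = begin
      ⌊ m ⌋ ∘ m                         ≈⟨ natural-X m m ⟨
      ⌊ m ∘ (m ⊗₁ id) ⌋                 ≈⟨ Inverse.to-cong (bijection _ _) m-assoc⁻¹ ⟩
      ⌊ m ∘ (id ⊗₁ m) ∘ α⁻¹ _ _ _ ⌋     ≈⟨ c-⌊⌋⊗⌊⌋ exp m m ⟨
      c ∘ (rep ⊗₁ rep)                  ∎

theorem2p10 : {o ℓ r : Level} (𝒞 : MonoidalCategory o ℓ r) (M : Monoid 𝒞)
    (exp : MonoidalCategory.Exponent 𝒞 (Monoid.Carrier M)) →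
    let open MonoidalCategory 𝒞
        open Endomorphisms 𝒞 exp
        open Representation 𝒞 M exp
    in IsSubmonoidVia M endomorphismMonoid rep × (abs ∘ rep ≈ id)
theorem2p10 𝒞 M exp =
  record
    { monic       = retraction⇒mono 𝒞 (abs∘rep 𝒞 M exp)
    ; preserves-e = rep-preserves-e 𝒞 M exp
    ; preserves-m = rep-preserves-m 𝒞 M exp
    }
  , abs∘rep 𝒞 M exp
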